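{- Let $E$ be a set and let $L$ be a sublattice of the lattice of equivalence relations on $E$ which contains the equality relation and is closed under arbitrary intersections. For $x,y\in E$ let $d(x,y)$ be the least member of $L$ containing the pair $(x,y)$, and let $\mathbf{E}:=(E,d)$, a generalized ultrametric space over $L$. Then $L$ is arithmetical if and only if $\mathbf{E}$ is finitely hyperconvex.
   Context: The set of equivalence relations on $E$ is a lattice under inclusion; its least element $0$ is the equality relation. Arbitrary intersections include the empty one, so that $E\times E\in L$ and $d$ is well defined. A sublattice $L$ of this lattice is arithmetical if it is distributive and any two members commute under composition: $\rho\circ\theta=\theta\circ\rho$ for all $\rho,\theta\in L$. Here $L$ is ordered by inclusion, with join $\vee$. For $a\in E$ and $r\in L$, the closed ball is $B(a,r):=\{x\in E: d(a,x)\leq r\}$. The space $\mathbf{E}$ is finitely hyperconvex if for every finite family of closed balls $(B(a_i,r_i))_{i\in I}$ with $a_i\in E$, $r_i\in L$, such that $d(a_i,a_j)\leq r_i\vee r_j$ for all $i,j\in I$, the intersection $\bigcap_{i\in I}B(a_i,r_i)$ is non-empty. -}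

module Defs where

open import Level using (Level; _⊔_; suc)
open import Data.Fin.Base using (Fin)
open import Data.Nat.Base using (ℕ)
open import Data.Product.Base using (Σ; ∃; _×_; _,_; proj₁; proj₂)
open import Data.Sum.Base using (inj₁; inj₂; [_,_])
open import Function.Base using (_on_)
open import Relation.Binary.Core using (Rel; _⇒_; _⇔_)
open import Relation.Binary.Construct.Composition using (_;_)
open import Relation.Binary.Construct.Intersection as Intersection using (_∩_)
open import Relation.Binary.Construct.Union using (_∪_)
open import Relation.Binary.Construct.Closure.Equivalence as Closure using (EqClosure)
open import Relation.Binary.Definitions using (_Respects_)
open import Relation.Binary.Lattice using (Lattice; IsDistributiveLattice)
open import Relation.Binary.PropositionalEquality as ≡ using (_≡_)
open import Relation.Binary.Structures using (IsEquivalence)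
open import Relation.Unary using (Pred; _∈_; _⊆_; Satisfiable; ⋂)

private
  variable
    a b c ℓ m : Level

record EquivRel (E : Set ℓ) : Set (suc ℓ) where
  field
    rel           : Rel E ℓ
    isEquivalence : IsEquivalence rel

open EquivRel public using (rel)

-- Equality in this lattice is mutual inclusion, i.e. equality of the
-- relations as sets of pairs.
equivLattice : Set ℓ → Lattice (suc ℓ) ℓ ℓ
equivLattice E = record
  { Carrier   = EquivRel E
  ; _≈_       = λ ρ θ → rel ρ ⇔ rel θ
  ; _≤_       = λ ρ θ → rel ρ ⇒ rel θ
  ; _∨_       = λ ρ θ → record
      { rel           = EqClosure (rel ρ ∪ rel θ)
      ; isEquivalence = Closure.isEquivalence (rel ρ ∪ rel θ)
      }
  ; _∧_       = λ ρ θ → record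
      { rel           = rel ρ ∩ rel θ
      ; isEquivalence = Intersection.isEquivalence
          (EquivRel.isEquivalence ρ) (EquivRel.isEquivalence θ)
      }
  ; isLattice = record
      { isPartialOrder = record
          { isPreorder = record
              { isEquivalence = record
                  { refl  = (λ p → p) , (λ p → p)
                  ; sym   = λ (f , g) → g , f
                  ; trans = λ (f , g) (h , k) → (λ p → h (f p)) , (λ p → g (k p))
                  }
              ; reflexive = proj₁
              ; trans     = λ f g p → g (f p)
              }
          ; antisym = λ f g → f , g
          }
      ; supremum = λ ρ θ →
            (λ p → Closure.return (inj₁ p))
          , (λ p → Closure.return (inj₂ p))
          , λ σ f g → Closure.fold (EquivRel.isEquivalence σ) [ f , g ]
      ; infimum  = λ ρ θ → proj₁ , proj₂ , λ σ f g p → f p , g p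
      }
  }

equality : (E : Set ℓ) → EquivRel E
equality E = record { rel = _≡_ ; isEquivalence = ≡.isEquivalence }

module _ (A : Lattice a b c) where
  open Lattice A

  record IsSublattice (L : Pred Carrier m) : Set (a ⊔ b ⊔ m) where
    field
      respects : L Respects _≈_
      ∨-closed : ∀ {x y} → x ∈ L → y ∈ L → (x ∨ y) ∈ L
      ∧-closed : ∀ {x y} → x ∈ L → y ∈ L → (x ∧ y) ∈ L

module _ {A : Lattice a b c} {L : Pred (Lattice.Carrier A) m} where
  open Lattice A

  toLattice : IsSublattice A L → Lattice (a ⊔ m) b c
  toLattice sub = record
    { Carrier   = Σ Carrier L
    ; _≈_       = _≈_ on proj₁
    ; _≤_       = _≤_ on proj₁
    ; _∨_       = λ (x , x∈L) (y , y∈L) → x ∨ y , ∨-closed x∈L y∈L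
    ; _∧_       = λ (x , x∈L) (y , y∈L) → x ∧ y , ∧-closed x∈L y∈L
    ; isLattice = record
        { isPartialOrder = record
            { isPreorder = record
                { isEquivalence = record
                    { refl  = Eq.refl
                    ; sym   = Eq.sym
                    ; trans = Eq.trans
                    }
                ; reflexive = reflexive
                ; trans     = trans
                }
            ; antisym = antisym
            }
        ; supremum = λ (x , _) (y , _) →
              x≤x∨y x y , y≤x∨y x y , λ _ → ∨-least
        ; infimum  = λ (x , _) (y , _) →
              x∧y≤x x y , x∧y≤y x y , λ _ → ∧-greatest
        }
    }
    where open IsSublattice sub

-- For empty P this is the full relation E × E.
⋂ᵣ : {E : Set ℓ} → Pred (EquivRel E) m → Rel E (suc ℓ ⊔ m)
⋂ᵣ P x y = ∀ σ → σ ∈ P → rel σ x y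

-- ⋂ᵣ P lives in a larger universe than the members of L, so closure asks for
-- a member of L with the same pairs as ⋂ᵣ P.
ClosedUnder⋂ : {E : Set ℓ} → Pred (EquivRel E) m → Set (suc (ℓ ⊔ m))
ClosedUnder⋂ {ℓ = ℓ} {m = m} {E = E} L =
  (P : Pred (EquivRel E) (ℓ ⊔ m)) → P ⊆ L →
  ∃ λ ρ → ρ ∈ L × (rel ρ ⇔ ⋂ᵣ P)

Arithmetical : {E : Set ℓ} {L : Pred (EquivRel E) m} →
               IsSublattice (equivLattice E) L → Set (suc ℓ ⊔ m)
Arithmetical {L = L} sub =
  IsDistributiveLattice _≈_ _≤_ _∨_ _∧_ ×
  (∀ {ρ θ} → ρ ∈ L → θ ∈ L → (rel ρ ; rel θ) ⇔ (rel θ ; rel ρ))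
  where open Lattice (toLattice sub)

module _ {E : Set ℓ} {L : Pred (EquivRel E) m} (closed : ClosedUnder⋂ L) where

  private
    Containing : E → E → Pred (EquivRel E) (ℓ ⊔ m)
    Containing x y ρ = ρ ∈ L × rel ρ x y

    least : (x y : E) → ∃ λ ρ → ρ ∈ L × (rel ρ ⇔ ⋂ᵣ (Containing x y))
    least x y = closed (Containing x y) proj₁

  distance : E → E → Σ (EquivRel E) L
  distance x y = let (ρ , ρ∈L , _) = least x y in ρ , ρ∈L

  distance-contains : ∀ x y → rel (proj₁ (distance x y)) x y
  distance-contains x y = proj₂ (proj₂ (proj₂ (least x y))) λ _ → proj₂

  distance-least : ∀ x y {σ} → σ ∈ L → rel σ x y →
                   rel (proj₁ (distance x y)) ⇒ rel σ
  distance-least x y {σ} σ∈L xσy p =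
    proj₁ (proj₂ (proj₂ (least x y))) p σ (σ∈L , xσy)

module _ {E : Set ℓ} (V : Lattice a b c) (d : E → E → Lattice.Carrier V) where
  open Lattice V

  ClosedBall : E → Carrier → Pred E c
  ClosedBall x r y = d x y ≤ r

  -- The empty family (n = 0) is included; its intersection is E.
  FinitelyHyperconvex : Set (ℓ ⊔ a ⊔ c)
  FinitelyHyperconvex =
    (n : ℕ) (x : Fin n → E) (r : Fin n → Carrier) →
    (∀ i j → d (x i) (x j) ≤ (r i ∨ r j)) →
    Satisfiable (⋂ (Fin n) (λ i → ClosedBall (x i) (r i)))

{-# OPTIONS --safe #-}

-- Since x lies in B(a , r) exactly when (a , x) ∈ r, finite hyperconvexity is
-- the Chinese remainder theorem for L: a system "z ≡ xᵢ modulo rᵢ" is solvable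
-- as soon as (xᵢ , xⱼ) ∈ rᵢ ∨ rⱼ for all i and j.  If L is arithmetical then
-- ρ ∨ θ = ρ ; θ, and the congruences are solved one at a time: a solution y of
-- all but the first satisfies (x₀ , y) ∈ ⋀ᵢ (r₀ ∨ rᵢ) = r₀ ∨ ⋀ᵢ rᵢ.  Conversely,
-- if x and y are related by both s ∨ t and r ∨ t, the balls B(x , s), B(x , r)
-- and B(y , t) have a common point z.  Commutation is the case r = s, and for
-- distributivity (x , y) ∈ r ∧ (s ∨ t) gives (x , z) ∈ r ∧ s and (z , y) ∈ r ∧ t.
module Submission where

open import Defs
open import Data.Fin.Base using (zero; suc)
open import Data.Nat.Base using (ℕ; zero; suc)
open import Data.Product.Base using (∃; _×_; _,_; proj₁; proj₂)
open import Data.Sum.Base using (inj₁; inj₂)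
open import Data.Vec.Functional using (Vector; []; _∷_; head; tail; foldr)
open import Function.Base using (_∘_)
open import Function.Bundles using (_⇔_; mk⇔)
open import Level using (Level)
open import Relation.Binary.Construct.Composition using (_;_)
import Relation.Binary.Construct.Closure.Equivalence as Closure
open import Relation.Binary.Core using (_⇒_)
open import Relation.Binary.Lattice using (Lattice; DistributiveLattice)
import Relation.Binary.Lattice.Properties.DistributiveLattice as DistributiveLatticeProperties
import Relation.Binary.Lattice.Properties.JoinSemilattice as JoinSemilatticeProperties
open import Relation.Binary.Structures using (IsEquivalence)
open import Relation.Unary using (Pred; _∈_)
open import Relation.Unary.Polymorphic using (∅)

private
  variable
    ℓ m : Level

module _ {E : Set ℓ} where
  private
    open module EqLat = Lattice (equivLattice E) using (_∨_)
    module Rel (ρ : EquivRel E) = IsEquivalence (EquivRel.isEquivalence ρ)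

  commuting⇒;-isEquivalence : ∀ ρ θ → rel θ ; rel ρ ⇒ rel ρ ; rel θ →
                              IsEquivalence (rel ρ ; rel θ)
  commuting⇒;-isEquivalence ρ θ θρ⇒ρθ = record
    { refl  = _ , Rel.refl ρ , Rel.refl θ
    ; sym   = λ (_ , p , q) → θρ⇒ρθ (_ , Rel.sym θ q , Rel.sym ρ p)
    ; trans = λ (_ , p , q) (_ , p′ , q′) →
        let (_ , p″ , q″) = θρ⇒ρθ (_ , q , p′)
        in _ , Rel.trans ρ p p″ , Rel.trans θ q″ q′
    }

  commuting⇒∨⊆; : ∀ ρ θ → rel θ ; rel ρ ⇒ rel ρ ; rel θ →
                  rel (ρ ∨ θ) ⇒ rel ρ ; rel θ
  commuting⇒∨⊆; ρ θ θρ⇒ρθ =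
    Closure.fold (commuting⇒;-isEquivalence ρ θ θρ⇒ρθ) λ where
      (inj₁ p) → _ , p , Rel.refl θ
      (inj₂ q) → _ , Rel.refl ρ , q

  ;⊆∨ : ∀ ρ θ → rel ρ ; rel θ ⇒ rel (ρ ∨ θ)
  ;⊆∨ ρ θ (_ , p , q) =
    Rel.trans (ρ ∨ θ) (EqLat.x≤x∨y ρ θ p) (EqLat.y≤x∨y ρ θ q)

module _ {E : Set ℓ} {L : Pred (EquivRel E) m}
         (sub : IsSublattice (equivLattice E) L) (closed : ClosedUnder⋂ L) where
  private
    open module Sub = Lattice (toLattice sub) using (Carrier; _∨_; _∧_)
    module R (r : Carrier) = IsEquivalence (EquivRel.isEquivalence (proj₁ r))

    infix 4 _⟨_⟩_
    _⟨_⟩_ : E → Carrier → E → Set ℓ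
    x ⟨ r ⟩ y = rel (proj₁ r) x y

    ∨-swap : ∀ r s {x y} → x ⟨ r ∨ s ⟩ y → y ⟨ s ∨ r ⟩ x
    ∨-swap r s = R.sym (s ∨ r) ∘
      proj₁ (JoinSemilatticeProperties.∨-comm Sub.joinSemilattice r s)

    ChineseRemainder : Set _
    ChineseRemainder =
      (n : ℕ) (x : Vector E n) (r : Vector Carrier n) →
      (∀ i j → x i ⟨ r i ∨ r j ⟩ x j) → ∃ λ z → ∀ i → x i ⟨ r i ⟩ z

    Hyperconvex : Set _
    Hyperconvex = FinitelyHyperconvex (toLattice sub) (distance closed)

  chineseRemainder⇒hyperconvex : ChineseRemainder → Hyperconvex
  chineseRemainder⇒hyperconvex crt n x r d≤ =
    let (z , xrz) = crt n x r λ i j → d≤ i j (distance-contains closed (x i) (x j))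
    in z , λ i → distance-least closed (x i) z (proj₂ (r i)) (xrz i)

  hyperconvex⇒chineseRemainder : Hyperconvex → ChineseRemainder
  hyperconvex⇒chineseRemainder hyp n x r xrx =
    let (z , d≤) = hyp n x r λ i j →
          distance-least closed (x i) (x j) (proj₂ (r i ∨ r j)) (xrx i j)
    in z , λ i → d≤ i (distance-contains closed (x i) z)

  private
    -- The intersection of the empty family, hence `E × E`. As the start of the fold in `⋀` it makes
    -- the meet of no radii impose no condition, as a system of a single congruence requires.
    ⊤ : Carrier
    ⊤ = let (ρ , ρ∈L , _) = closed ∅ (λ ()) in ρ , ρ∈L

    ⊤-total : ∀ {x y} → x ⟨ ⊤ ⟩ y
    ⊤-total = proj₂ (proj₂ (proj₂ (closed ∅ (λ ())))) λ _ ()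

    ⋀ : ∀ {n} → Vector Carrier n → Carrier
    ⋀ = foldr _∧_ ⊤

    ⋀-lower : ∀ {n} (r : Vector Carrier n) {x y} → x ⟨ ⋀ r ⟩ y → ∀ i → x ⟨ r i ⟩ y
    ⋀-lower r (p , _) zero    = p
    ⋀-lower r (_ , p) (suc i) = ⋀-lower (tail r) p i

  module _ (arith : Arithmetical sub) where
    private
      distributiveLattice : DistributiveLattice _ _ _
      distributiveLattice = record { isDistributiveLattice = proj₁ arith }

      open DistributiveLatticeProperties distributiveLattice using (∨-distribˡ-∧)

      -- Induction on `n` with the dual distributive law, join over meet, which follows from the
      -- meet-over-join law in `arith`.
      ∨-⋀ : ∀ {n} s (r : Vector Carrier n) {x y} →
            (∀ i → x ⟨ s ∨ r i ⟩ y) → x ⟨ s ∨ ⋀ r ⟩ y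
      ∨-⋀ {zero}  s r _ = Sub.y≤x∨y s ⊤ ⊤-total
      ∨-⋀ {suc n} s r p =
        proj₂ (∨-distribˡ-∧ s (head r) (⋀ (tail r)))
          (p zero , ∨-⋀ s (tail r) (p ∘ suc))

      ∨⊆; : ∀ s t {x y} → x ⟨ s ∨ t ⟩ y → ∃ λ z → x ⟨ s ⟩ z × z ⟨ t ⟩ y
      ∨⊆; (ρ , ρ∈L) (θ , θ∈L) =
        commuting⇒∨⊆; ρ θ (proj₂ (proj₂ arith ρ∈L θ∈L))

    arithmetical⇒chineseRemainder : E → ChineseRemainder
    -- Any point solves the empty system; this is where an inhabitant of `E` is used.
    arithmetical⇒chineseRemainder e zero    x r xrx = e , λ ()
    arithmetical⇒chineseRemainder e (suc n) x r xrx = z , solves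
      where
      rest : ∃ λ y → ∀ i → x (suc i) ⟨ r (suc i) ⟩ y
      rest = arithmetical⇒chineseRemainder e n (tail x) (tail r) λ i j → xrx (suc i) (suc j)

      y : E
      y = proj₁ rest

      -- The path from `x zero` to `y` goes through `x (suc i)`.
      x₀≈y : ∀ i → x zero ⟨ r zero ∨ r (suc i) ⟩ y
      x₀≈y i = R.trans (r zero ∨ r (suc i)) (xrx zero (suc i))
        (Sub.y≤x∨y (r zero) (r (suc i)) (proj₂ rest i))

      -- Moving from `y` to `z` inside `⋀ (tail r)` preserves every congruence already solved.
      common : ∃ λ z → x zero ⟨ r zero ⟩ z × z ⟨ ⋀ (tail r) ⟩ y
      common = ∨⊆; (r zero) (⋀ (tail r)) (∨-⋀ (r zero) (tail r) x₀≈y)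

      z : E
      z = proj₁ common

      solves : ∀ i → x i ⟨ r i ⟩ z
      solves zero    = proj₁ (proj₂ common)
      solves (suc i) = R.trans (r (suc i)) (proj₂ rest i)
        (R.sym (r (suc i)) (⋀-lower (tail r) (proj₂ (proj₂ common)) i))

  module _ (crt : ChineseRemainder) where
    private
      -- Two of the balls share the centre `x`, so compatibility reduces to reflexivity, `p`, `q`
      -- and the transposes of `p` and `q`.
      threeBalls : ∀ {x y} s r t → x ⟨ s ∨ t ⟩ y → x ⟨ r ∨ t ⟩ y →
                   ∃ λ z → x ⟨ s ⟩ z × x ⟨ r ⟩ z × y ⟨ t ⟩ z
      threeBalls {x} {y} s r t p q =
        let (z , solves) = crt 3 centre radius compatible
        in z , solves zero , solves (suc zero) , solves (suc (suc zero))
        where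
        centre : Vector E 3
        centre = x ∷ x ∷ y ∷ []

        radius : Vector Carrier 3
        radius = s ∷ r ∷ t ∷ []

        compatible : ∀ i j → centre i ⟨ radius i ∨ radius j ⟩ centre j
        compatible zero             zero             = R.refl (s ∨ s)
        compatible zero             (suc zero)       = R.refl (s ∨ r)
        compatible zero             (suc (suc zero)) = p
        compatible (suc zero)       zero             = R.refl (r ∨ s)
        compatible (suc zero)       (suc zero)       = R.refl (r ∨ r)
        compatible (suc zero)       (suc (suc zero)) = q
        compatible (suc (suc zero)) zero             = ∨-swap s t p
        compatible (suc (suc zero)) (suc zero)       = ∨-swap r t q
        compatible (suc (suc zero)) (suc (suc zero)) = R.refl (t ∨ t)

      ;-comm : ∀ s t {x y} → (rel (proj₁ s) ; rel (proj₁ t)) x y →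
               (rel (proj₁ t) ; rel (proj₁ s)) x y
      ;-comm s t {x} {y} p =
        -- `∨-swap` exchanges both the joinands and the endpoints; `R.sym` restores the endpoints.
        let x∨y = R.sym (t ∨ s) (∨-swap s t (;⊆∨ (proj₁ s) (proj₁ t) p))
            (z , xtz , _ , ysz) = threeBalls t t s x∨y x∨y
        in z , xtz , R.sym s ysz

      ∧-∨-distrib-≤ : ∀ r s t {x y} → x ⟨ r ∧ (s ∨ t) ⟩ y → x ⟨ (r ∧ s) ∨ (r ∧ t) ⟩ y
      ∧-∨-distrib-≤ r s t (xry , x∨y) =
        -- The balls of radii `r` and `t` are compatible because `x` and `y` are already related by
        -- `r`.
        let (z , xsz , xrz , ytz) = threeBalls s r t x∨y (Sub.x≤x∨y r t xry)
        in ;⊆∨ (proj₁ (r ∧ s)) (proj₁ (r ∧ t))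
             -- Both `z` and `y` are related to `x` by `r`, hence to each other.
             (z , (xrz , xsz) , R.trans r (R.sym r xrz) xry , R.sym t ytz)

      ∧-∨-distrib-≥ : ∀ r s t → (r ∧ s) ∨ (r ∧ t) Sub.≤ r ∧ (s ∨ t)
      ∧-∨-distrib-≥ r s t = Sub.∨-least {r ∧ s} {r ∧ t} {r ∧ (s ∨ t)}
        (λ (p , q) → p , Sub.x≤x∨y s t q)
        (λ (p , q) → p , Sub.y≤x∨y s t q)

    chineseRemainder⇒arithmetical : Arithmetical sub
    chineseRemainder⇒arithmetical =
      record
        { isLattice    = Sub.isLattice
        ; ∧-distribˡ-∨ = λ r s t → ∧-∨-distrib-≤ r s t , ∧-∨-distrib-≥ r s t
        } ,
      λ {ρ} {θ} ρ∈L θ∈L → ;-comm (ρ , ρ∈L) (θ , θ∈L) , ;-comm (θ , θ∈L) (ρ , ρ∈L)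

theorem7p2 : ∀ {ℓ m} (E : Set ℓ) → E →
    (L : Pred (EquivRel E) m) (sub : IsSublattice (equivLattice E) L) →
    equality E ∈ L → (closed : ClosedUnder⋂ L) →
    Arithmetical sub ⇔ FinitelyHyperconvex (toLattice sub) (distance closed)
theorem7p2 E e L sub _ closed = mk⇔
  (λ arith → chineseRemainder⇒hyperconvex sub closed
    (arithmetical⇒chineseRemainder sub closed arith e))
  (λ hyp → chineseRemainder⇒arithmetical sub closed
    (hyperconvex⇒chineseRemainder sub closed hyp))
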